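{- Let $n\ge5$. If $n$ is an odd integer, then the distance matrix $D(H_n)$ of the helm graph $H_n$ is singular.
   Context: Helm graph: for $n\ge4$, the wheel $W_n$ consists of a cycle on $v_1,\dots,v_{n-1}$ together with a vertex $v_0$ adjacent to all $v_i$; the helm graph $H_n$ (on $2n-1$ vertices) is obtained from $W_n$ by attaching to each $v_i$, $1\le i\le n-1$, a pendant vertex $u_i$. The distance matrix $D(H_n)$ has as entries the shortest-path distances, with vertices ordered $v_0,v_1,\dots,v_{n-1},u_1,\dots,u_{n-1}$. Explicitly, $$D(H_n)=\begin{bmatrix}0&\mathbf{e}'&2\mathbf{e}'\\ \mathbf{e}&2J_{n-1}-S&3J_{n-1}-S\\ 2\mathbf{e}&3J_{n-1}-S&4J_{n-1}-S-2I_{n-1}\end{bmatrix},$$ where a prime denotes transpose, $\mathbf{e}\in\mathbb{R}^{n-1}$ is the all-ones vector, $J_{n-1}$ the all-ones matrix, $I_{n-1}$ the identity, and $S$ is the circulant matrix of order $n-1$ with first row $(2,1,0,\dots,0,1)$ (each row is the previous one cyclically shifted one place to the right). -}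

module Defs where

open import Algebra.Definitions.RawMonoid using (sum)
open import Data.Fin.Base using (Fin; zero; suc; toℕ; splitAt; join)
open import Data.Fin.Properties using (any?; splitAt-join) renaming (_≟_ to _≟ᶠ_)
open import Data.Integer.Base as ℤ using (ℤ; +_; 0ℤ; 1ℤ; -1ℤ)
open import Data.Nat.Base using (ℕ; zero; suc; _+_; _∸_; _≤_; _<_; z≤n; s≤s)
open import Data.Nat.Properties using (_≟_; 1+n≢n; ≤⇒≯; ≤-refl; suc-injective)
open import Data.Product.Base using (∃; ∃-syntax; _×_; _,_; proj₁; proj₂)
open import Data.Sum.Base using (_⊎_; inj₁; inj₂; [_,_]′)
open import Data.Vec.Functional using (Vector; removeAt)
open import Relation.Binary.Construct.Closure.Symmetric using (SymClosure; fwd; bwd; symmetric)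
open import Relation.Binary.Definitions using (Decidable; Symmetric)
open import Relation.Binary.PropositionalEquality.Core using (_≡_; refl; sym; trans; cong; subst)
open import Relation.Nullary.Decidable.Core using (Dec; yes; no; map′; _×-dec_; _⊎-dec_)
open import Relation.Nullary.Negation.Core using (¬_; contradiction)
import Relation.Unary as U

------------------------------------------------------------------------
-- Matrices

Matrix : Set → ℕ → Set
Matrix A n = Fin n → Fin n → A

-- Laplace expansion along the first row.
det : ∀ {n} → Matrix ℤ n → ℤ
det {zero}  A = 1ℤ
det {suc n} A = sum ℤ.+-0-rawMonoid λ j →
  (-1ℤ ℤ.^ toℕ j) ℤ.* A zero j ℤ.* det (λ i → removeAt (A (suc i)) j)

-- The determinant of an integer matrix is the same whether it is computed
-- over ℤ or over ℝ, so this is singularity as a real matrix (and not merely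
-- the absence of an inverse over ℤ).
Singular : ∀ {n} → Matrix ℤ n → Set
Singular A = det A ≡ 0ℤ

------------------------------------------------------------------------
-- Graphs and distances

record Graph (N : ℕ) : Set₁ where
  field
    Adj        : Fin N → Fin N → Set
    adj?       : Decidable Adj
    adj-sym    : Symmetric Adj
    adj-irrefl : ∀ {x} → ¬ Adj x x

module _ {N : ℕ} (G : Graph N) where
  open Graph G

  data Walk : ℕ → Fin N → Fin N → Set where
    here : ∀ {x} → Walk 0 x x
    step : ∀ {k x y z} → Adj x y → Walk k y z → Walk (suc k) x z

  Connected : Set
  Connected = ∀ x y → ∃[ k ] Walk k x y

  IsDistance : Fin N → Fin N → ℕ → Set
  IsDistance x y d = Walk d x y × (∀ k → Walk k x y → d ≤ k)

  walk? : ∀ k → Decidable (Walk k)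
  walk? zero    x y = map′ (λ { refl → here }) (λ { here → refl }) (x ≟ᶠ y)
  walk? (suc k) x z = map′ (λ (_ , a , w) → step a w) (λ { (step a w) → _ , a , w })
    (any? λ y → adj? x y ×-dec walk? k y z)

least : ∀ {P : ℕ → Set} → U.Decidable P → ∃ P → ∃[ d ] P d × (∀ k → P k → d ≤ k)
least {P} P? (n , Pn) = go n P? Pn
  where
  go : ∀ n {P : ℕ → Set} → U.Decidable P → P n → ∃[ d ] P d × (∀ k → P k → d ≤ k)
  go zero    P? P0 = 0 , P0 , λ _ _ → z≤n
  go (suc n) P? Pn with P? 0
  ... | yes P0 = 0 , P0 , λ _ _ → z≤n
  ... | no ¬P0 with go n (λ k → P? (suc k)) Pn
  ...   | d , Pd , min = suc d , Pd ,
          λ { zero P0 → contradiction P0 ¬P0 ; (suc k) Pk → s≤s (min k Pk) }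

module _ {N : ℕ} (G : Graph N) (conn : Connected G) where

  shortest : ∀ x y → ∃ (IsDistance G x y)
  shortest x y = least (λ k → walk? G k x y) (conn x y)

  distance : Fin N → Fin N → ℕ
  distance x y = proj₁ (shortest x y)

  distanceMatrix : Matrix ℤ N
  distanceMatrix x y = + distance x y

------------------------------------------------------------------------
-- The helm graph

-- The vertices v₀, vᵢ and uᵢ, where m = n - 1 and Fin m is the index set
-- 1 ≤ i ≤ n - 1 shifted down by one.
data Vertex (m : ℕ) : Set where
  hub     : Vertex m
  rim     : Fin m → Vertex m
  pendant : Fin m → Vertex m

CyclicSucc : ∀ {m} → Fin m → Fin m → Set
CyclicSucc {m} i j = suc (toℕ i) ≡ toℕ j ⊎ (suc (toℕ i) ≡ m × toℕ j ≡ 0)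

data Edge {m : ℕ} : Vertex m → Vertex m → Set where
  spoke  : ∀ i → Edge hub (rim i)
  cycle  : ∀ {i j} → CyclicSucc i j → Edge (rim i) (rim j)
  pendantEdge : ∀ i → Edge (rim i) (pendant i)

HelmAdj : ∀ {m} → Vertex m → Vertex m → Set
HelmAdj = SymClosure Edge

order : ℕ → ℕ
order n = 1 + ((n ∸ 1) + (n ∸ 1))

-- The ordering v₀, v₁, …, vₙ₋₁, u₁, …, uₙ₋₁ of the vertices.
vertex : ∀ n → Fin (order n) → Vertex (n ∸ 1)
vertex n zero    = hub
vertex n (suc k) = [ rim , pendant ]′ (splitAt (n ∸ 1) k)

index : ∀ n → Vertex (n ∸ 1) → Fin (order n)
index n hub         = zero
index n (rim i)     = suc (join (n ∸ 1) (n ∸ 1) (inj₁ i))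
index n (pendant i) = suc (join (n ∸ 1) (n ∸ 1) (inj₂ i))

vertex-index : ∀ n v → vertex n (index n v) ≡ v
vertex-index n hub = refl
vertex-index n (rim i)
  rewrite splitAt-join (n ∸ 1) (n ∸ 1) (inj₁ i) = refl
vertex-index n (pendant i)
  rewrite splitAt-join (n ∸ 1) (n ∸ 1) (inj₂ i) = refl

edge? : ∀ {m} → Decidable (Edge {m})
edge? hub         hub         = no λ ()
edge? hub         (rim i)     = yes (spoke i)
edge? hub         (pendant i) = no λ ()
edge? (rim i)     hub         = no λ ()
edge? {m} (rim i) (rim j)     = map′ cycle (λ { (cycle s) → s })
  ((suc (toℕ i) ≟ toℕ j) ⊎-dec ((suc (toℕ i) ≟ m) ×-dec (toℕ j ≟ 0)))
edge? (rim i)     (pendant j) =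
  map′ (λ { refl → pendantEdge i }) (λ { (pendantEdge _) → refl }) (i ≟ᶠ j)
edge? (pendant i) _           = no λ ()

helmAdj? : ∀ {m} → Decidable (HelmAdj {m})
helmAdj? x y = map′ (λ { (inj₁ e) → fwd e ; (inj₂ e) → bwd e })
                    (λ { (fwd e) → inj₁ e ; (bwd e) → inj₂ e })
                    (edge? x y ⊎-dec edge? y x)

edge-irrefl : ∀ {m} → 2 ≤ m → ∀ {v : Vertex m} → ¬ Edge v v
edge-irrefl 2≤m (cycle (inj₁ p))       = 1+n≢n p
edge-irrefl 2≤m (cycle (inj₂ (p , q))) =
  ≤⇒≯ 2≤m (subst (_< 2) (trans (cong suc (sym q)) p) ≤-refl)

helm : ∀ n → 4 ≤ n → Graph (order n)
helm n 4≤n = record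
  { Adj        = λ x y → HelmAdj (vertex n x) (vertex n y)
  ; adj?       = λ x y → helmAdj? (vertex n x) (vertex n y)
  ; adj-sym    = symmetric Edge
  ; adj-irrefl = λ { (fwd e) → edge-irrefl (2≤ 4≤n) e ; (bwd e) → edge-irrefl (2≤ 4≤n) e }
  }
  where
  2≤ : ∀ {n} → 4 ≤ n → 2 ≤ n ∸ 1
  2≤ (s≤s (s≤s (s≤s _))) = s≤s (s≤s z≤n)

module _ {N : ℕ} (G : Graph N) where
  open Graph G

  _▷_ : ∀ {k x y z} → Walk G k x y → Adj y z → Walk G (suc k) x z
  here     ▷ b = step b here
  step a w ▷ b = step a (w ▷ b)

  reverse : ∀ {k x y} → Walk G k x y → Walk G k y x
  reverse here       = here
  reverse (step a w) = reverse w ▷ adj-sym a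

  append : ∀ {k l x y z} → Walk G k x y → Walk G l y z → Walk G (k + l) x z
  append here       w = w
  append (step a v) w = step a (append v w)

helm-connected : ∀ n (4≤n : 4 ≤ n) → Connected (helm n 4≤n)
helm-connected n 4≤n x y =
  _ , append G (proj₂ (toHub x)) (reverse G (proj₂ (toHub y)))
  where
  G = helm n 4≤n

  relabel : ∀ {x u v} y → vertex n x ≡ u → vertex n y ≡ v →
            HelmAdj u v → Graph.Adj G x y
  relabel _ refl refl a = a

  toHub : ∀ x → ∃[ k ] Walk G k x zero
  toHub zero = 0 , here
  toHub (suc k) with splitAt (n ∸ 1) k in eq
  ... | inj₁ i = 1 , step (relabel zero (cong [ rim , pendant ]′ eq) refl (bwd (spoke i))) here
  ... | inj₂ i = 2 ,
    step (relabel (index n (rim i)) (cong [ rim , pendant ]′ eq) (vertex-index n (rim i)) (bwd (pendantEdge i)))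
      (step (relabel zero (vertex-index n (rim i)) refl (bwd (spoke i))) here)

D[H] : ∀ n → 4 ≤ n → Matrix ℤ (order n)
D[H] n 4≤n = distanceMatrix (helm n 4≤n) (helm-connected n 4≤n)

-- Write m = n − 1, which is even. The vector that is (−1)^i at the rim vertex vᵢ
-- and 0 elsewhere is a nonzero kernel vector of D(Hₙ): around the even cycle the
-- alternating vector w satisfies S w = 0 and J w = 0, so the blocks e′, 2J − S
-- and 3J − S all annihilate it. A linear relation among distinct columns, one of
-- whose coefficients is 1, makes the determinant vanish.
module Submission where

open import Defs
open import Data.Bool.Base using (if_then_else_)
open import Data.Fin.Base as Fin using (Fin; zero; suc; toℕ; fromℕ<; inject₁; punchIn; punchOut; splitAt)
open import Data.Fin.Induction using (<-weakInduction)
import Data.Fin.Properties as Fin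
open import Data.Integer.Base as ℤ using (ℤ; +_; -[1+_]; 0ℤ; 1ℤ; -1ℤ; _*_; -_) renaming (_+_ to _⊕_)
import Data.Integer.Properties as ℤ
open import Data.Integer.Tactic.RingSolver using (solve-∀)
open import Data.Nat.Base using (ℕ; zero; suc; _≤_; _<_; z≤n; s≤s; s≤s⁻¹; _∸_; _%_)
open import Data.Nat.Properties using (<⇒≤)
import Data.Nat.Properties as ℕ
open import Data.Product.Base using (∃; _,_; proj₁)
open import Data.Sum.Base using (inj₁; inj₂; [_,_]′)
open import Data.Vec.Functional using (Vector; removeAt; updateAt)
open import Data.Vec.Functional.Properties using (updateAt-updates; updateAt-minimal; updateAt-id-local)
open import Function.Base using (_∘_; const)
open import Function.Definitions using (Injective)
open import Relation.Binary.Construct.Closure.Symmetric using (fwd; bwd; symmetric)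
open import Relation.Binary.Definitions using (tri<; tri≈; tri>)
open import Relation.Binary.PropositionalEquality
open import Relation.Nullary.Decidable using (yes; no; does; dec-true; dec-false)
open import Relation.Nullary.Negation using (¬_; contradiction)

open import Algebra.Properties.Semiring.Sum ℤ.+-*-semiring
  using (sum; sum-cong-≗; sum-remove; sum-replicate-zero; ∑-comm; ∑-distrib-+; *-distribˡ-sum; *-distribʳ-sum)
open ≡-Reasoning

private variable
  m n p : ℕ

-- Signs and finite integer sums.

-1^_ : ∀ {n} → Fin n → ℤ
-1^ i = -1ℤ ℤ.^ toℕ i

sum-zero : (t : Vector ℤ n) → (∀ i → t i ≡ 0ℤ) → sum t ≡ 0ℤ
sum-zero {n} t t≗0 = trans (sum-cong-≗ t≗0) (sum-replicate-zero n)

sum-single : (t : Vector ℤ n) (i : Fin n) → (∀ j → j ≢ i → t j ≡ 0ℤ) → sum t ≡ t i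
sum-single {suc _} t i t≡0 = begin
  sum t                     ≡⟨ sum-remove {i = i} t ⟩
  t i ⊕ sum (removeAt t i)  ≡⟨ cong (t i ⊕_) (sum-zero _ λ j → t≡0 _ (Fin.punchInᵢ≢i i j)) ⟩
  t i ⊕ 0ℤ                  ≡⟨ ℤ.+-identityʳ (t i) ⟩
  t i                       ∎

sum-neg : (t : Vector ℤ n) → sum (λ i → - t i) ≡ - sum t
sum-neg t = begin
  sum (λ i → - t i)       ≡⟨ sum-cong-≗ (λ i → ℤ.-1*i≡-i (t i)) ⟨
  sum (λ i → -1ℤ * t i)   ≡⟨ *-distribˡ-sum -1ℤ t ⟨
  -1ℤ * sum t             ≡⟨ ℤ.-1*i≡-i (sum t) ⟩
  - sum t                 ∎

-- Determinants of integer matrices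

minor : Matrix ℤ (suc n) → Fin (suc n) → Matrix ℤ n
minor A j i = removeAt (A (suc i)) j

det-cong : {A B : Matrix ℤ n} → (∀ i j → A i j ≡ B i j) → det A ≡ det B
det-cong {zero}  A≗B = refl
det-cong {suc n} A≗B = sum-cong-≗ λ j →
  cong₂ _*_ (cong (-1^ j *_) (A≗B zero j)) (det-cong λ i k → A≗B (suc i) (punchIn j k))

-- The transposition of inject₁ k and suc k.
swap : Fin n → Fin (suc n) → Fin (suc n)
swap zero    zero          = suc zero
swap zero    (suc zero)    = zero
swap zero    (suc (suc i)) = suc (suc i)
swap (suc k) zero          = zero
swap (suc k) (suc i)       = suc (swap k i)

sum-swap : (k : Fin n) (t : Vector ℤ (suc n)) → sum (t ∘ swap k) ≡ sum t
sum-swap zero    t = exchange (t (suc zero)) (t zero) _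
  where
  exchange : ∀ a b c → a ⊕ (b ⊕ c) ≡ b ⊕ (a ⊕ c)
  exchange = solve-∀
sum-swap (suc k) t = cong (t zero ⊕_) (sum-swap k (t ∘ suc))

swap-inject₁ : (k : Fin n) → swap k (inject₁ k) ≡ suc k
swap-inject₁ zero    = refl
swap-inject₁ (suc k) = cong suc (swap-inject₁ k)

swap-other : (k : Fin n) {i : Fin (suc n)} → i ≢ inject₁ k → i ≢ suc k → swap k i ≡ i
swap-other zero    {zero}        i≢0 i≢1 = contradiction refl i≢0
swap-other zero    {suc zero}    i≢0 i≢1 = contradiction refl i≢1
swap-other zero    {suc (suc i)} i≢0 i≢1 = refl
swap-other (suc k) {zero}        i≢k i≢1+k = refl
swap-other (suc k) {suc i}       i≢k i≢1+k = cong suc (swap-other k (i≢k ∘ cong suc) (i≢1+k ∘ cong suc))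

∘-swap : (k : Fin n) (t : Vector ℤ (suc n)) → t (inject₁ k) ≡ t (suc k) → t ∘ swap k ≗ t
∘-swap zero    t eq zero          = sym eq
∘-swap zero    t eq (suc zero)    = eq
∘-swap zero    t eq (suc (suc i)) = refl
∘-swap (suc k) t eq zero          = refl
∘-swap (suc k) t eq (suc i)       = ∘-swap k (t ∘ suc) eq i

-- The transposition at k either restricts to an adjacent transposition of the
-- minor omitting column j, or carries that minor unchanged to a neighbouring one.
data SwapPunchIn : ∀ {n} → Fin n → Fin (suc n) → Set where
  moved : {k : Fin n} {j : Fin (suc n)} →
          -1^ swap k j ≡ - (-1^ j) →
          (∀ i → swap k (punchIn j i) ≡ punchIn (swap k j) i) →
          SwapPunchIn k j
  fixed : {k : Fin (suc n)} {j : Fin (suc (suc n))} (k′ : Fin n) →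
          swap k j ≡ j →
          (∀ i → swap k (punchIn j i) ≡ punchIn j (swap k′ i)) →
          SwapPunchIn k j

swapPunchIn : (k : Fin n) (j : Fin (suc n)) → SwapPunchIn k j
swapPunchIn zero    zero       = moved refl λ { zero → refl ; (suc i) → refl }
swapPunchIn zero    (suc zero) = moved refl λ { zero → refl ; (suc i) → refl }
swapPunchIn {suc (suc _)} zero (suc (suc j)) =
  fixed zero refl λ { zero → refl ; (suc zero) → refl ; (suc (suc i)) → refl }
swapPunchIn {suc (suc _)} (suc k) zero = fixed k refl λ i → refl
swapPunchIn {suc (suc _)} (suc k) (suc j) with swapPunchIn k j
... | moved sign comm = moved (trans (cong (-1ℤ *_) sign) (sym (ℤ.neg-distribʳ-* -1ℤ (-1^ j))))
                              λ { zero → refl ; (suc i) → cong suc (comm i) }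
... | fixed k′ eq comm = fixed (suc k′) (cong suc eq) λ { zero → refl ; (suc i) → cong suc (comm i) }

-- The term at `j` of the new expansion is minus the old term at `swap k j`. If `j` moves, the two
-- minors coincide and the cofactor sign flips, because an adjacent transposition shifts a position
-- by exactly one. If `j` is fixed, sign and entry stay the same and the minor undergoes an adjacent
-- transposition itself, so induction on the size applies.
det-swap : (k : Fin n) (A : Matrix ℤ (suc n)) → det (λ i → A i ∘ swap k) ≡ - det A
det-swap k A = begin
  sum (λ j → -1^ j * A zero (swap k j) * det (minor A∘swap j))  ≡⟨ sum-cong-≗ term-swap ⟩
  sum (λ j → - term (swap k j))                                 ≡⟨ sum-neg (term ∘ swap k) ⟩
  - sum (term ∘ swap k)                                         ≡⟨ cong -_ (sum-swap k term) ⟩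
  - sum term                                                    ∎
  where
  A∘swap : Matrix ℤ _
  A∘swap i = A i ∘ swap k

  term : Vector ℤ _
  term j = -1^ j * A zero j * det (minor A j)

  neg-sign : ∀ s a d → s * a * d ≡ - (- s * a * d)
  neg-sign = solve-∀

  term-swap : ∀ j → -1^ j * A zero (swap k j) * det (minor A∘swap j) ≡ - term (swap k j)
  term-swap j with swapPunchIn k j
  ... | moved sign comm = begin
    -1^ j * A zero (swap k j) * det (minor A∘swap j)
      ≡⟨ cong (-1^ j * A zero (swap k j) *_) (det-cong λ i l → cong (A (suc i)) (comm l)) ⟩
    -1^ j * A zero (swap k j) * det (minor A (swap k j))
      ≡⟨ neg-sign (-1^ j) (A zero (swap k j)) _ ⟩
    - (- (-1^ j) * A zero (swap k j) * det (minor A (swap k j)))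
      ≡⟨ cong (λ s → - (s * A zero (swap k j) * det (minor A (swap k j)))) sign ⟨
    - term (swap k j) ∎
  ... | fixed k′ eq comm = begin
    -1^ j * A zero (swap k j) * det (minor A∘swap j)
      ≡⟨ cong₂ _*_ (cong (λ l → -1^ j * A zero l) eq) (det-cong λ i l → cong (A (suc i)) (comm l)) ⟩
    -1^ j * A zero j * det (λ i → minor A j i ∘ swap k′)
      ≡⟨ cong (-1^ j * A zero j *_) (det-swap k′ (minor A j)) ⟩
    -1^ j * A zero j * - det (minor A j)
      ≡⟨ ℤ.neg-distribʳ-* (-1^ j * A zero j) (det (minor A j)) ⟨
    - term j
      ≡⟨ cong (-_ ∘ term) eq ⟨
    - term (swap k j) ∎

i≡-i⇒i≡0 : ∀ i → i ≡ - i → i ≡ 0ℤ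
i≡-i⇒i≡0 (+ zero)  _  = refl
i≡-i⇒i≡0 (+ suc _) ()
i≡-i⇒i≡0 -[1+ _ ]  ()

-- Induction on the right-hand column `l`: adjacent swaps carry it leftwards until it stands next to
-- column `k`. There one more swap leaves the matrix unchanged but negates the determinant, so
-- `det A ≡ - det A`. The motive quantifies over all matrices since each swap alters the matrix.
det-equal-columns-< : {A : Matrix ℤ (suc n)} {k l : Fin (suc n)} → k Fin.< l →
                      (∀ i → A i k ≡ A i l) → det A ≡ 0ℤ
det-equal-columns-< {n} {A} {k} {l} =
  <-weakInduction (λ l → ∀ A → k Fin.< l → (∀ i → A i k ≡ A i l) → det A ≡ 0ℤ)
    (λ _ ()) induct l A
  where
  induct : ∀ l → (∀ A → k Fin.< inject₁ l → (∀ i → A i k ≡ A i (inject₁ l)) → det A ≡ 0ℤ) →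
         ∀ A → k Fin.< suc l → (∀ i → A i k ≡ A i (suc l)) → det A ≡ 0ℤ
  induct l ih A k<1+l eq with k Fin.≟ inject₁ l
  ... | yes refl = i≡-i⇒i≡0 (det A) (trans (det-cong λ i j → sym (∘-swap l (A i) (eq i) j)) (det-swap l A))
  ... | no k≢l = ℤ.neg-injective (trans (sym (det-swap l A)) (ih (λ i → A i ∘ swap l) k<l λ i → begin
    A i (swap l k)            ≡⟨ cong (A i) (swap-other l k≢l (Fin.<⇒≢ k<1+l)) ⟩
    A i k                     ≡⟨ eq i ⟩
    A i (suc l)               ≡⟨ cong (A i) (swap-inject₁ l) ⟨
    A i (swap l (inject₁ l))  ∎))
    where
    k<l : k Fin.< inject₁ l
    k<l = Fin.≤∧≢⇒< (subst (toℕ k ≤_) (sym (Fin.toℕ-inject₁ l)) (ℕ.m<1+n⇒m≤n k<1+l)) k≢l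

det-equal-columns : {A : Matrix ℤ n} {k l : Fin n} → k ≢ l → (∀ i → A i k ≡ A i l) → det A ≡ 0ℤ
det-equal-columns {suc _} {k = k} {l} k≢l eq with Fin.<-cmp k l
... | tri< k<l _ _ = det-equal-columns-< k<l eq
... | tri≈ _ k≡l _ = contradiction k≡l k≢l
... | tri> _ _ l<k = det-equal-columns-< l<k (sym ∘ eq)

-- Multilinearity in column `k`, for a whole linear combination at once. In the expansion term at
-- `j = k` the combination sits in the first-row entry and all the minors agree. In the other terms
-- column `k` survives in the minor, at position `punchOut j≢k`, and the induction hypothesis
-- applies there.
det-linear : (k : Fin n) (v : Vector ℤ p) (B : Fin p → Matrix ℤ n) {A : Matrix ℤ n} →
             (∀ l i j → j ≢ k → B l i j ≡ A i j) →
             (∀ i → A i k ≡ sum λ l → v l * B l i k) →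
             det A ≡ sum λ l → v l * det (B l)
det-linear {suc n} k v B {A} off at = begin
  sum (λ j → term A j)                      ≡⟨ sum-cong-≗ term-linear ⟩
  sum (λ j → sum λ l → v l * term (B l) j)  ≡⟨ ∑-comm (λ j l → v l * term (B l) j) ⟩
  sum (λ l → sum λ j → v l * term (B l) j)  ≡⟨ sum-cong-≗ (λ l → *-distribˡ-sum (v l) (term (B l))) ⟨
  sum (λ l → v l * det (B l))               ∎
  where
  term : Matrix ℤ (suc n) → Vector ℤ (suc n)
  term A j = -1^ j * A zero j * det (minor A j)

  pull-entry : ∀ s x b d → s * (x * b) * d ≡ x * (s * b * d)
  pull-entry = solve-∀

  pull-minor : ∀ s a x d → s * a * (x * d) ≡ x * (s * a * d)
  pull-minor = solve-∀

  term-linear : ∀ j → term A j ≡ sum λ l → v l * term (B l) j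
  term-linear j with j Fin.≟ k
  ... | yes refl = begin
    -1^ j * A zero j * d
      ≡⟨ cong (λ a → -1^ j * a * d) (at zero) ⟩
    -1^ j * sum (λ l → v l * B l zero j) * d
      ≡⟨ cong (_* d) (*-distribˡ-sum (-1^ j) (λ l → v l * B l zero j)) ⟩
    sum (λ l → -1^ j * (v l * B l zero j)) * d
      ≡⟨ *-distribʳ-sum d (λ l → -1^ j * (v l * B l zero j)) ⟩
    sum (λ l → -1^ j * (v l * B l zero j) * d)
      ≡⟨ sum-cong-≗ (λ l → trans (pull-entry (-1^ j) (v l) (B l zero j) d)
           (cong (λ e → v l * (-1^ j * B l zero j * e))
             (det-cong λ i i′ → sym (off l (suc i) (punchIn j i′) (Fin.punchInᵢ≢i j i′))))) ⟩
    sum (λ l → v l * term (B l) j) ∎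
    where
    d : ℤ
    d = det (minor A j)
  ... | no j≢k = begin
    -1^ j * A zero j * det (minor A j)
      ≡⟨ cong (-1^ j * A zero j *_) (det-linear k′ v (λ l → minor (B l) j)
           (λ l i i′ i′≢k′ → off l (suc i) (punchIn j i′)
             λ eq → i′≢k′ (Fin.punchIn-injective j i′ k′ (trans eq (sym punchIn-k′))))
           (λ i → subst (λ k → A (suc i) k ≡ sum λ l → v l * B l (suc i) k) (sym punchIn-k′) (at (suc i)))) ⟩
    -1^ j * A zero j * sum (λ l → v l * det (minor (B l) j))
      ≡⟨ *-distribˡ-sum (-1^ j * A zero j) (λ l → v l * det (minor (B l) j)) ⟩
    sum (λ l → -1^ j * A zero j * (v l * det (minor (B l) j)))
      ≡⟨ sum-cong-≗ (λ l → trans (pull-minor (-1^ j) (A zero j) (v l) _)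
           (cong (λ a → v l * (-1^ j * a * det (minor (B l) j))) (sym (off l zero j j≢k)))) ⟩
    sum (λ l → v l * term (B l) j) ∎
    where
    k′ : Fin n
    k′ = punchOut j≢k
    punchIn-k′ : punchIn j k′ ≡ k
    punchIn-k′ = Fin.punchIn-punchOut j≢k

det-dependent-columns : {A : Matrix ℤ n} {c : Fin p → Fin n} → Injective _≡_ _≡_ c →
                        (v : Vector ℤ p) → (∀ i → sum (λ l → v l * A i (c l)) ≡ 0ℤ) →
                        ∀ l → v l * det A ≡ 0ℤ
-- Replace column c l by the vanishing combination of the columns c l′; the zero
-- column is moreover the empty combination (p = 0).
det-dependent-columns {n} {p} {A} {c} c-inj v dep l = begin
  v l * det A                       ≡⟨ cong (v l *_) (det-cong λ i → updateAt-id-local (c l) (A i) refl) ⟨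
  v l * det (B l)                   ≡⟨ sum-single (λ l′ → v l′ * det (B l′)) l repeated ⟨
  sum (λ l′ → v l′ * det (B l′))    ≡⟨ det-linear (c l) v B unchanged (λ i → sym (combination i)) ⟨
  det (replace (const 0ℤ))          ≡⟨ det-linear {p = 0} (c l) (λ ()) (λ ()) (λ ()) (replaced (const 0ℤ)) ⟩
  0ℤ                                ∎
  where
  replace : Vector ℤ n → Matrix ℤ n
  replace x i = updateAt (A i) (c l) (const (x i))

  column : Fin p → Vector ℤ n
  column l′ i = A i (c l′)

  B : Fin p → Matrix ℤ n
  B l′ = replace (column l′)

  replaced : ∀ x i → replace x i (c l) ≡ x i
  replaced x i = updateAt-updates (c l) (A i)

  unreplaced : ∀ x i j → j ≢ c l → replace x i j ≡ A i j
  unreplaced x i j j≢k = updateAt-minimal j (c l) (A i) j≢k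

  unchanged : ∀ l′ i j → j ≢ c l → B l′ i j ≡ replace (const 0ℤ) i j
  unchanged l′ i j j≢k = trans (unreplaced (column l′) i j j≢k) (sym (unreplaced (const 0ℤ) i j j≢k))

  combination : ∀ i → sum (λ l′ → v l′ * B l′ i (c l)) ≡ replace (const 0ℤ) i (c l)
  combination i = begin
    sum (λ l′ → v l′ * B l′ i (c l))  ≡⟨ sum-cong-≗ (λ l′ → cong (v l′ *_) (replaced (column l′) i)) ⟩
    sum (λ l′ → v l′ * A i (c l′))    ≡⟨ dep i ⟩
    0ℤ                                ≡⟨ replaced (const 0ℤ) i ⟨
    replace (const 0ℤ) i (c l)        ∎

  repeated : ∀ l′ → l′ ≢ l → v l′ * det (B l′) ≡ 0ℤ
  -- `B l′` carries column `c l′` twice, at position `c l` and at its own; injectivity of `c` keeps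
  -- the two positions apart.
  repeated l′ l′≢l = trans (cong (v l′ *_) (det-equal-columns (l′≢l ∘ sym ∘ c-inj) equal)) (ℤ.*-zeroʳ (v l′))
    where
    equal : ∀ i → B l′ i (c l) ≡ B l′ i (c l′)
    equal i = trans (replaced (column l′) i) (sym (unreplaced (column l′) i (c l′) (l′≢l ∘ c-inj)))

-- Alternating signs on an even number of indices.

-1^m≡1 : ∀ m → suc m % 2 ≡ 1 → -1ℤ ℤ.^ m ≡ 1ℤ
-1^m≡1 zero          _   = refl
-- Evenness of `m` is stated as oddness of `suc m`, the form in which the hypothesis on `n` arrives.
-- Removing two successors preserves the remainder by computation, and `m = 1` is absurd because
-- `2 % 2` reduces to 0.
-1^m≡1 (suc (suc m)) odd = cong (λ s → -1ℤ * (-1ℤ * s)) (-1^m≡1 m odd)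

sum-signs : ∀ m → suc m % 2 ≡ 1 → sum {m} -1^_ ≡ 0ℤ
sum-signs zero          _   = refl
sum-signs (suc (suc m)) odd = begin
  1ℤ ⊕ (-1ℤ ⊕ sum {m} (λ i → -1ℤ * (-1ℤ * -1^ i)))
    ≡⟨ cong (λ s → 1ℤ ⊕ (-1ℤ ⊕ s)) (sum-cong-≗ {m} (λ i → involutive (-1^ i))) ⟩
  1ℤ ⊕ (-1ℤ ⊕ sum {m} -1^_)
    ≡⟨ cong (λ s → 1ℤ ⊕ (-1ℤ ⊕ s)) (sum-signs m odd) ⟩
  0ℤ ∎
  where
  involutive : ∀ x → -1ℤ * (-1ℤ * x) ≡ x
  involutive = solve-∀

-- The rim cycle and distances in the helm

cyclicSucc-functional : {i j j′ : Fin m} → CyclicSucc i j → CyclicSucc i j′ → j ≡ j′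
cyclicSucc-functional (inj₁ p) (inj₁ q) = Fin.toℕ-injective (trans (sym p) q)
cyclicSucc-functional {j = j} (inj₁ p) (inj₂ (q , _)) =
  contradiction (trans (sym p) q) (ℕ.<⇒≢ (Fin.toℕ<n j))
cyclicSucc-functional {j′ = j′} (inj₂ (p , _)) (inj₁ q) =
  contradiction (trans (sym q) p) (ℕ.<⇒≢ (Fin.toℕ<n j′))
cyclicSucc-functional (inj₂ (_ , p)) (inj₂ (_ , q)) = Fin.toℕ-injective (trans p (sym q))

cyclicSucc-injective : {i i′ j : Fin m} → CyclicSucc i j → CyclicSucc i′ j → i ≡ i′
cyclicSucc-injective (inj₁ p) (inj₁ q) = Fin.toℕ-injective (ℕ.suc-injective (trans p (sym q)))
cyclicSucc-injective (inj₁ p) (inj₂ (_ , q)) = contradiction (trans p q) λ ()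
cyclicSucc-injective (inj₂ (_ , p)) (inj₁ q) = contradiction (trans q p) λ ()
cyclicSucc-injective (inj₂ (p , _)) (inj₂ (q , _)) = Fin.toℕ-injective (ℕ.suc-injective (trans p (sym q)))

next : (i : Fin m) → ∃ λ j → CyclicSucc i j
next {suc m} i with suc (toℕ i) ℕ.≟ suc m
... | yes eq = zero , inj₂ (eq , refl)
... | no neq = fromℕ< i+1<m , inj₁ (sym (Fin.toℕ-fromℕ< i+1<m))
  where
  i+1<m : suc (toℕ i) < suc m
  i+1<m = ℕ.≤∧≢⇒< (Fin.toℕ<n i) neq

prev : (j : Fin m) → ∃ λ i → CyclicSucc i j
prev {suc m} zero    = Fin.fromℕ m , inj₂ (cong suc (Fin.toℕ-fromℕ m) , refl)
prev {suc m} (suc j) = Fin.inject₁ j , inj₁ (cong suc (Fin.toℕ-inject₁ j))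

cyclicSucc-irrefl : 2 ≤ m → {i : Fin m} → ¬ CyclicSucc i i
cyclicSucc-irrefl 2≤m = edge-irrefl 2≤m ∘ cycle

-- Two plain steps would increase the index by 2 and yet return to it, a plain step together with a
-- wrap-around forces `m = 2`, and two wrap-arounds force `m = 1`.
cyclicSucc-asym : 3 ≤ m → {i j : Fin m} → CyclicSucc i j → ¬ CyclicSucc j i
cyclicSucc-asym 3≤m {i} {j} (inj₁ p) (inj₁ q) =
  contradiction (subst (toℕ i <_) (trans (cong suc p) q) (ℕ.m≤n+m _ 1)) (ℕ.<-irrefl refl)
cyclicSucc-asym 3≤m (inj₁ p) (inj₂ (q , r)) =
  contradiction (subst (3 ≤_) (trans (sym q) (cong suc (trans (sym p) (cong suc r)))) 3≤m) (ℕ.<⇒≱ ℕ.≤-refl)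
cyclicSucc-asym 3≤m (inj₂ (p , r)) (inj₁ q) =
  contradiction (subst (3 ≤_) (trans (sym p) (cong suc (trans (sym q) (cong suc r)))) 3≤m) (ℕ.<⇒≱ ℕ.≤-refl)
cyclicSucc-asym 3≤m (inj₂ (p , r)) (inj₂ (_ , s)) =
  contradiction (subst (3 ≤_) (trans (sym p) (cong suc s)) 3≤m) λ { (s≤s ()) }

-- For even m the signs alternate around the whole cycle, including the wrap-around.
sign-alternates : suc m % 2 ≡ 1 → {i j : Fin m} → CyclicSucc i j → -1^ j ≡ - (-1^ i)
sign-alternates {m} odd {i} {j} s = trans (sign s) (ℤ.-1*i≡-i (-1^ i))
  where
  sign : CyclicSucc i j → -1^ j ≡ -1ℤ * -1^ i
  sign (inj₁ p)       = cong (-1ℤ ℤ.^_) (sym p)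
  sign (inj₂ (p , q)) = trans (cong (-1ℤ ℤ.^_) q) (sym (trans (cong (-1ℤ ℤ.^_) p) (-1^m≡1 m odd)))

-- The value 2 stands for the path through the hub. Indexing by the value lets a single case split
-- expose both the number and the reason for it.
data RimDistance {m : ℕ} (i j : Fin m) : ℕ → Set where
  same     : i ≡ j → RimDistance i j 0
  adjacent : i ≢ j → HelmAdj (rim i) (rim j) → RimDistance i j 1
  far      : i ≢ j → ¬ HelmAdj (rim i) (rim j) → RimDistance i j 2

rimDistance? : (i j : Fin m) → ∃ (RimDistance i j)
rimDistance? i j with i Fin.≟ j | helmAdj? (rim i) (rim j)
... | yes i≡j | _      = 0 , same i≡j
... | no  i≢j | yes a  = 1 , adjacent i≢j a
... | no  i≢j | no  ¬a = 2 , far i≢j ¬a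

rimDistance : Fin m → Fin m → ℕ
rimDistance i j = proj₁ (rimDistance? i j)

-- A closed form for the distance to `rim i`, shown to be correct in `distance-toRim`. A pendant
-- vertex is one step further away than its only neighbour.
toRim : Fin m → Vertex m → ℕ
toRim i hub         = 1
toRim i (rim j)     = rimDistance i j
toRim i (pendant j) = suc (rimDistance i j)

rimDistance-refl : (i : Fin m) → rimDistance i i ≡ 0
rimDistance-refl i with rimDistance? i i
... | 0 , same _         = refl
... | 1 , adjacent i≢i _ = contradiction refl i≢i
... | 2 , far i≢i _      = contradiction refl i≢i

rimDistance≤2 : (i j : Fin m) → rimDistance i j ≤ 2
rimDistance≤2 i j with rimDistance? i j
... | 0 , same _       = z≤n
... | 1 , adjacent _ _ = s≤s z≤n
... | 2 , far _ _      = ℕ.≤-refl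

rimDistance-adjacent : {i j : Fin m} → HelmAdj (rim i) (rim j) → rimDistance i j ≤ 1
rimDistance-adjacent {i = i} {j} a with rimDistance? i j
... | 0 , same _       = z≤n
... | 1 , adjacent _ _ = ℕ.≤-refl
... | 2 , far _ ¬a     = contradiction a ¬a

-- Since rim distances never exceed 2, only the case `i ≡ k` makes use of the adjacency.
rimDistance-lipschitz : (i : Fin m) {j k : Fin m} → HelmAdj (rim j) (rim k) →
                        rimDistance i j ≤ suc (rimDistance i k)
rimDistance-lipschitz i {j} {k} a with rimDistance? i k
... | 0 , same refl    = rimDistance-adjacent (symmetric Edge a)
... | 1 , adjacent _ _ = rimDistance≤2 i j
... | 2 , far _ _      = ℕ.m≤n⇒m≤1+n (rimDistance≤2 i j)

-- This gives the lower bound on distances: a function that vanishes at the target and drops by at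
-- most one along each edge cannot exceed the length of a walk to the target.
toRim-lipschitz : (i : Fin m) {u v : Vertex m} → HelmAdj u v → toRim i u ≤ suc (toRim i v)
toRim-lipschitz i (fwd (spoke j))       = s≤s z≤n
toRim-lipschitz i (bwd (spoke j))       = rimDistance≤2 i j
toRim-lipschitz i (fwd (cycle s))       = rimDistance-lipschitz i (fwd (cycle s))
toRim-lipschitz i (bwd (cycle s))       = rimDistance-lipschitz i (bwd (cycle s))
toRim-lipschitz i (fwd (pendantEdge j)) = ℕ.m≤n+m _ 2
toRim-lipschitz i (bwd (pendantEdge j)) = ℕ.≤-refl

index-vertex : ∀ n x → index n (vertex n x) ≡ x
index-vertex n zero    = refl
index-vertex n (suc k) = trans (index-[] (splitAt (n ∸ 1) k)) (cong suc (Fin.join-splitAt (n ∸ 1) (n ∸ 1) k))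
  where
  index-[] : ∀ s → index n ([ rim , pendant ]′ s) ≡ suc (Fin.join (n ∸ 1) (n ∸ 1) s)
  index-[] (inj₁ i) = refl
  index-[] (inj₂ i) = refl

module _ (n : ℕ) (4≤n : 4 ≤ n) where

  private
    G : Graph (order n)
    G = helm n 4≤n

  adj-index : ∀ x {u} v → vertex n x ≡ u → HelmAdj u v → Graph.Adj G x (index n v)
  adj-index x v refl a = subst (HelmAdj _) (sym (vertex-index n v)) a

  -- The start is any index with a proof of which vertex it names, so that the walk applies to an
  -- arbitrary matrix row as well as to the rim vertex reached from a pendant one.
  rimWalkToRim : ∀ i j x → vertex n x ≡ rim j → Walk G (rimDistance i j) x (index n (rim i))
  rimWalkToRim i j x eq with rimDistance? i j
  ... | 0 , same refl    = subst (λ y → Walk G 0 y (index n (rim i)))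
                             (trans (cong (index n) (sym eq)) (index-vertex n x)) here
  ... | 1 , adjacent _ a = step (adj-index x (rim i) eq (symmetric Edge a)) here
  ... | 2 , far _ _      = step {y = zero} (adj-index x hub eq (bwd (spoke j)))
                             (step (adj-index zero (rim i) refl (fwd (spoke i))) here)

  walkToRim : ∀ i v x → vertex n x ≡ v → Walk G (toRim i v) x (index n (rim i))
  walkToRim i hub         x eq = step (adj-index x (rim i) eq (fwd (spoke i))) here
  walkToRim i (rim j)     x eq = rimWalkToRim i j x eq
  walkToRim i (pendant j) x eq =
    step (adj-index x (rim j) eq (bwd (pendantEdge j))) (rimWalkToRim i j _ (vertex-index n (rim j)))

  toRim≤length : ∀ i {k x y} → vertex n y ≡ rim i → Walk G k x y → toRim i (vertex n x) ≤ k
  toRim≤length i eq here       = ℕ.≤-reflexive (trans (cong (toRim i) eq) (rimDistance-refl i))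
  toRim≤length i eq (step a w) = ℕ.≤-trans (toRim-lipschitz i a) (s≤s (toRim≤length i eq w))

  -- The explicit walk bounds the minimal length from above, the Lipschitz estimate bounds it from
  -- below.
  distance-toRim : ∀ (conn : Connected G) x i → distance G conn x (index n (rim i)) ≡ toRim i (vertex n x)
  distance-toRim conn x i with shortest G conn x (index n (rim i))
  ... | d , w , minimal = ℕ.≤-antisym (minimal _ (walkToRim i (vertex n x) x refl))
                                      (toRim≤length i (vertex-index n (rim i)) w)

  index-rim-injective : ∀ {i j} → index n (rim i) ≡ index n (rim j) → i ≡ j
  index-rim-injective = Fin.↑ˡ-injective (n ∸ 1) _ _ ∘ Fin.suc-injective

-- Alternating sums of distances over the rim.

δ : Fin m → Fin m → ℤ
δ i j = if does (i Fin.≟ j) then 1ℤ else 0ℤ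

δ-≡ : {i j : Fin m} → i ≡ j → δ i j ≡ 1ℤ
δ-≡ {i = i} {j} i≡j = cong (if_then 1ℤ else 0ℤ) (dec-true (i Fin.≟ j) i≡j)

δ-≢ : {i j : Fin m} → i ≢ j → δ i j ≡ 0ℤ
δ-≢ {i = i} {j} i≢j = cong (if_then 1ℤ else 0ℤ) (dec-false (i Fin.≟ j) i≢j)

sum-δ : (t : Fin m → ℤ) (j : Fin m) → sum (λ i → t i * δ i j) ≡ t j
sum-δ t j = begin
  sum (λ i → t i * δ i j)  ≡⟨ sum-single _ j (λ i i≢j → trans (cong (t i *_) (δ-≢ i≢j)) (ℤ.*-zeroʳ (t i))) ⟩
  t j * δ j j              ≡⟨ cong (t j *_) (δ-≡ {i = j} refl) ⟩
  t j * 1ℤ                 ≡⟨ ℤ.*-identityʳ (t j) ⟩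
  t j                      ∎

-- The column of vⱼ in D + S = 2J, for the rim block D = 2J − S of the distance matrix.
rimDistance-δ : 3 ≤ m → {p j q : Fin m} → CyclicSucc p j → CyclicSucc j q → ∀ i →
                (+ rimDistance i j) ⊕ (δ i j ⊕ δ i j ⊕ (δ i p ⊕ δ i q)) ≡ + 2
rimDistance-δ 3≤m {p} {j} {q} pj jq i with rimDistance? i j
... | 0 , same refl
  rewrite δ-≡ {i = j} refl
        | δ-≢ {i = j} {p} (λ { refl → cyclicSucc-irrefl (<⇒≤ 3≤m) pj })
        | δ-≢ {i = j} {q} (λ { refl → cyclicSucc-irrefl (<⇒≤ 3≤m) jq }) = refl
-- A rim neighbour of `j` equals exactly one of `p` and `q`; being both would close the cycle after
-- two steps, which `3 ≤ m` excludes.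
... | 1 , adjacent i≢j (fwd (cycle ij))
  rewrite δ-≢ i≢j
        | δ-≡ (cyclicSucc-injective ij pj)
        | δ-≢ {i = i} {q} (λ { refl → cyclicSucc-asym 3≤m ij jq }) = refl
... | 1 , adjacent i≢j (bwd (cycle ji))
  rewrite δ-≢ i≢j
        | δ-≡ (cyclicSucc-functional ji jq)
        | δ-≢ {i = i} {p} (λ { refl → cyclicSucc-asym 3≤m ji pj }) = refl
... | 2 , far i≢j ¬a
  rewrite δ-≢ i≢j
        | δ-≢ {i = i} {p} (λ { refl → ¬a (fwd (cycle pj)) })
        | δ-≢ {i = i} {q} (λ { refl → ¬a (bwd (cycle jq)) }) = refl

module _ (3≤m : 3 ≤ m) (odd : suc m % 2 ≡ 1) where

  -- Adding column `j` of `S`, written with `δ` at `j` twice and at its neighbours `p` and `q`, does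
  -- not change the alternating sum: the contributions cancel because both neighbours have the sign
  -- opposite to that of `j`. The enlarged column is constantly 2, so what remains is twice the sum
  -- of all signs.
  rim-alternating-sum : (j : Fin m) → sum {m} (λ i → -1^ i * (+ rimDistance i j)) ≡ 0ℤ
  rim-alternating-sum j with prev j | next j
  ... | p , pj | q , jq = begin
    D                                               ≡⟨ ℤ.+-identityʳ D ⟨
    D ⊕ 0ℤ                                          ≡⟨ cong (D ⊕_) cancel ⟨
    D ⊕ (sum (at j) ⊕ sum (at j) ⊕ (sum (at p) ⊕ sum (at q)))
      ≡⟨ cong (D ⊕_) (cong₂ _⊕_ (∑-distrib-+ (at j) (at j)) (∑-distrib-+ (at p) (at q))) ⟨
    D ⊕ (sum (λ i → at j i ⊕ at j i) ⊕ sum (λ i → at p i ⊕ at q i))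
      ≡⟨ cong (D ⊕_) (∑-distrib-+ (λ i → at j i ⊕ at j i) (λ i → at p i ⊕ at q i)) ⟨
    D ⊕ sum (λ i → at j i ⊕ at j i ⊕ (at p i ⊕ at q i))
      ≡⟨ ∑-distrib-+ d (λ i → at j i ⊕ at j i ⊕ (at p i ⊕ at q i)) ⟨
    sum (λ i → d i ⊕ (at j i ⊕ at j i ⊕ (at p i ⊕ at q i)))
      ≡⟨ sum-cong-≗ pointwise ⟩
    sum {m} (λ i → + 2 * -1^ i)                     ≡⟨ *-distribˡ-sum (+ 2) (-1^_ {m}) ⟨
    + 2 * sum {m} -1^_                              ≡⟨ cong (+ 2 *_) (sum-signs m odd) ⟩
    0ℤ                                              ∎
    where
    d : Fin m → ℤ
    d i = -1^ i * (+ rimDistance i j)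

    D : ℤ
    D = sum d

    at : Fin m → Fin m → ℤ
    at l i = -1^ i * δ i l

    opposite-signs : ∀ s → s ⊕ s ⊕ (- s ⊕ - s) ≡ 0ℤ
    opposite-signs = solve-∀

    cancel : sum (at j) ⊕ sum (at j) ⊕ (sum (at p) ⊕ sum (at q)) ≡ 0ℤ
    cancel = trans (cong₂ _⊕_ (cong₂ _⊕_ (sum-δ -1^_ j) (sum-δ -1^_ j)) (cong₂ _⊕_
        -- Alternation along `pj` expresses the sign of `j` through that of `p`; a double negation
        -- turns this around.
        (trans (sum-δ -1^_ p) (trans (sym (ℤ.neg-involutive (-1^ p))) (cong -_ (sym (sign-alternates odd pj)))))
        (trans (sum-δ -1^_ q) (sign-alternates odd jq))))
      (opposite-signs (-1^ j))

    factor : ∀ s a b c d → s * a ⊕ (s * b ⊕ s * b ⊕ (s * c ⊕ s * d)) ≡ (a ⊕ (b ⊕ b ⊕ (c ⊕ d))) * s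
    factor = solve-∀

    pointwise : ∀ i → d i ⊕ (at j i ⊕ at j i ⊕ (at p i ⊕ at q i)) ≡ + 2 * -1^ i
    pointwise i = trans (factor (-1^ i) (+ rimDistance i j) (δ i j) (δ i p) (δ i q))
                        (cong (_* -1^ i) (rimDistance-δ 3≤m pj jq i))

  -- The cases are the three block rows of the distance matrix, restricted to the rim columns. A
  -- pendant row is the matching rim row plus the all-ones hub row.
  alternating-sum : (u : Vertex m) → sum {m} (λ i → -1^ i * (+ toRim i u)) ≡ 0ℤ
  alternating-sum hub         = trans (sum-cong-≗ (ℤ.*-identityʳ ∘ -1^_ {m})) (sum-signs m odd)
  alternating-sum (rim j)     = rim-alternating-sum j
  alternating-sum (pendant j) = begin
    sum {m} (λ i → -1^ i * (1ℤ ⊕ (+ rimDistance i j)))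
      ≡⟨ sum-cong-≗ (λ i → ℤ.*-distribˡ-+ (-1^ i) 1ℤ (+ rimDistance i j)) ⟩
    sum {m} (λ i → -1^ i * 1ℤ ⊕ -1^ i * (+ rimDistance i j))
      ≡⟨ ∑-distrib-+ {m} (λ i → -1^ i * 1ℤ) (λ i → -1^ i * (+ rimDistance i j)) ⟩
    sum {m} (λ i → -1^ i * 1ℤ) ⊕ sum {m} (λ i → -1^ i * (+ rimDistance i j))
      ≡⟨ cong₂ _⊕_ (alternating-sum hub) (rim-alternating-sum j) ⟩
    0ℤ ∎

theorem3p1 : ∀ (n : ℕ) (5≤n : 5 ≤ n) → n % 2 ≡ 1 → Singular (D[H] n (<⇒≤ 5≤n))
theorem3p1 1 (s≤s ())
theorem3p1 n@(suc (suc m)) 5≤n odd = begin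
  det D        ≡⟨ ℤ.*-identityˡ (det D) ⟨
  -- Matching on two successors makes `n ∸ 1` reduce to `suc m`, so the rim has a vertex `zero`. Its
  -- coefficient `-1^ zero` is 1, hence the determinant itself vanishes and not just a multiple of
  -- it.
  1ℤ * det D   ≡⟨ det-dependent-columns {A = D} (index-rim-injective n 4≤n) -1^_ dependent zero ⟩
  0ℤ           ∎
  where
  4≤n : 4 ≤ n
  4≤n = <⇒≤ 5≤n

  D : Matrix ℤ (order n)
  D = D[H] n 4≤n

  dependent : ∀ x → sum (λ i → -1^ i * D x (index n (rim i))) ≡ 0ℤ
  dependent x = begin
    sum (λ i → -1^ i * D x (index n (rim i)))
      ≡⟨ sum-cong-≗ (λ i → cong (λ d → -1^ i * (+ d)) (distance-toRim n 4≤n (helm-connected n 4≤n) x i)) ⟩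
    sum (λ i → -1^ i * (+ toRim i (vertex n x)))
      ≡⟨ alternating-sum (s≤s⁻¹ 4≤n) odd (vertex n x) ⟩
    0ℤ ∎
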